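{- (1) For every integer $n\ge 2$, $\min\{e(i): 2^{n-1}\le i\le 2^{n}\}=\lfloor n/2\rfloor$. (2) For every integer $n\ge 1$, $\max\{e(i): 2^{n-1}\le i\le 2^{n}\}=n$. (3) For every integer $n\ge 0$, $\min\{i\ge 1: e(i)=n\}=2^{n}$. (4) For every integer $n\ge 0$, $\max\{i\ge 1: e(i)=n\}=\dfrac{4^{n+1}-1}{3}$.
   Context: The Stern polynomials $B_n(t)\in\mathbb{Z}[t]$, $n\ge 0$, are defined by $B_0(t)=0$, $B_1(t)=1$, $B_{2n}(t)=tB_n(t)$ and $B_{2n+1}(t)=B_n(t)+B_{n+1}(t)$ for $n\ge 1$. For $n\ge 1$, $e(n)=\deg_t B_n(t)$. -}

module Defs where

open import Data.Bool.Base using (if_then_else_)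
open import Data.Integer.Base as ℤ using (ℤ; 0ℤ; 1ℤ)
open import Data.Integer.Properties as ℤₚ using ()
open import Data.List.Base using (List; []; _∷_)
open import Data.List.Relation.Unary.All using (all?)
open import Data.Nat.Base
open import Data.Nat.Induction using (<-rec; <-Rec; <-wellFounded)
open import Data.Nat.Properties
open import Data.Parity.Base using (0ℙ; 1ℙ)
open import Data.Product.Base using (_×_)
open import Induction.WellFounded using (module FixPoint)
open import Level using (0ℓ)
open import Relation.Binary.PropositionalEquality
open import Relation.Nullary.Decidable using (does)
open import Relation.Unary using (Pred; _∈_)

-- ℤ[t] as coefficient lists, constant term first.  Trailing zeros are allowed:
-- lists differing only in trailing zeros stand for the same polynomial.
Poly : Set
Poly = List ℤ

infixl 6 _⊕_

_⊕_ : Poly → Poly → Poly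
[]      ⊕ q       = q
(a ∷ p) ⊕ []      = a ∷ p
(a ∷ p) ⊕ (b ∷ q) = (a ℤ.+ b) ∷ (p ⊕ q)

-- Multiplication by t.
t·_ : Poly → Poly
t· p = 0ℤ ∷ p

-- The index of the last nonzero coefficient; the zero polynomial gets 0.
deg : Poly → ℕ
deg []      = 0
deg (a ∷ p) = if does (all? (ℤₚ._≟ 0ℤ) p) then 0 else suc (deg p)

-- For k ≥ 2 even, k = 2n with n = ⌊ k /2⌋; for k ≥ 2 odd, k = 2n + 1 with
-- n = ⌊ k /2⌋ and n + 1 = ⌈ k /2⌉.  The recurrences in terms of n are proved
-- below as B-even and B-odd.
sternStep : ∀ k → <-Rec (λ _ → Poly) k → Poly
sternStep 0                 rec = []
sternStep 1                 rec = 1ℤ ∷ []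
sternStep k@(suc (suc k-2)) rec with parity k
... | 0ℙ = t· rec (⌊n/2⌋<n (suc k-2))
... | 1ℙ = rec (⌊n/2⌋<n (suc k-2)) ⊕ rec (⌈n/2⌉<n k-2)

B : ℕ → Poly
B = <-rec (λ _ → Poly) sternStep

private
  sternStep-ext : ∀ k {r r′ : <-Rec (λ _ → Poly) k} →
                  (∀ {j} j<k → r {j} j<k ≡ r′ j<k) →
                  sternStep k r ≡ sternStep k r′
  sternStep-ext 0                 eq = refl
  sternStep-ext 1                 eq = refl
  sternStep-ext k@(suc (suc k-2)) eq with parity k
  ... | 0ℙ = cong t·_ (eq _)
  ... | 1ℙ = cong₂ _⊕_ (eq _) (eq _)

  B-unfold : ∀ k → B k ≡ sternStep k (λ {j} _ → B j)
  B-unfold k = FixPoint.unfold-wfRec <-wellFounded (λ _ → Poly)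
                 sternStep sternStep-ext {k}

  parity-2* : ∀ n → parity (2 * n) ≡ 0ℙ
  parity-2* zero    = refl
  parity-2* (suc n) rewrite +-suc n (n + 0) = parity-2* n

  parity-1+2* : ∀ n → parity (suc (2 * n)) ≡ 1ℙ
  parity-1+2* zero    = refl
  parity-1+2* (suc n) rewrite +-suc n (n + 0) = parity-1+2* n

  ⌊2*/2⌋ : ∀ n → ⌊ 2 * n /2⌋ ≡ n
  ⌊2*/2⌋ zero    = refl
  ⌊2*/2⌋ (suc n) rewrite +-suc n (n + 0) = cong suc (⌊2*/2⌋ n)

  ⌊1+2*/2⌋ : ∀ n → ⌊ suc (2 * n) /2⌋ ≡ n
  ⌊1+2*/2⌋ zero    = refl
  ⌊1+2*/2⌋ (suc n) rewrite +-suc n (n + 0) = cong suc (⌊1+2*/2⌋ n)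

B-zero : B 0 ≡ []
B-zero = refl

B-one : B 1 ≡ 1ℤ ∷ []
B-one = refl

B-even : ∀ n → 1 ≤ n → B (2 * n) ≡ t· B n
B-even (suc n) _
  rewrite B-unfold (2 * suc n) | +-suc n (n + 0) | parity-2* n | ⌊2*/2⌋ n = refl

B-odd : ∀ n → 1 ≤ n → B (2 * n + 1) ≡ B n ⊕ B (n + 1)
B-odd (suc n) _
  rewrite +-comm (2 * suc n) 1 | B-unfold (suc (2 * suc n)) | +-suc n (n + 0)
        | parity-1+2* n | ⌊1+2*/2⌋ n | ⌊2*/2⌋ n | +-comm n 1 = refl

e : ℕ → ℕ
e n = deg (B n)

IsMin : Pred ℕ 0ℓ → ℕ → Set
IsMin S m = m ∈ S × (∀ {k} → k ∈ S → m ≤ k)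

IsMax : Pred ℕ 0ℓ → ℕ → Set
IsMax S m = m ∈ S × (∀ {k} → k ∈ S → k ≤ m)

{-# OPTIONS --safe #-}

-- Nonnegativity of the coefficients rules out cancellation, so e (2k) = e k + 1
-- and e (2k + 1) = max (e k) (e (k + 1)).  These recurrences give, by induction,
-- 2 ^ e i ≤ i and 3i + 1 ≤ 4 ^ (e i + 1), which are the bounds in all four parts.
-- The bounds are attained at the powers of 2, where e (2i) = e i + 1, and at the
-- iterates of i ↦ 4i + 1, which also raises e by exactly 1 because
-- e (i + 1) ≤ e i + 1.
module Submission where

open import Defs
open import Data.Bool.Base using (Bool; true; false; _∧_)
open import Data.Bool.Properties using (∧-zeroʳ)
open import Data.Fin.Base using (zero; suc)
open import Data.Integer.Base as ℤ using (0ℤ; +_; +≤+)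
open import Data.Integer.Properties as ℤₚ using ()
open import Data.List.Base using ([]; _∷_)
open import Data.List.Relation.Unary.All using (All; []; _∷_; all?)
open import Data.Nat.Base
  using (ℕ; zero; suc; _+_; _*_; _∸_; _^_; _/_; _≤_; _<_; _⊔_; ⌊_/2⌋; z≤n; s≤s)
open import Data.Nat.DivMod using (_divMod_; result; m*n/n≡m)
open import Data.Nat.Induction using (<-rec)
open import Data.Nat.Properties
open import Data.Nat.Tactic.RingSolver using (solve-∀)
open import Data.Product.Base using (_×_; _,_; ∃-syntax)
open import Relation.Binary.PropositionalEquality
  using (_≡_; refl; sym; trans; cong; cong₂; subst)
open import Relation.Nullary.Decidable using (does)

-- Degrees of sums of polynomials with nonnegative coefficients.

isZero : Poly → Bool
isZero p = does (all? (ℤₚ._≟ 0ℤ) p)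

NonNegative : Poly → Set
NonNegative = All (0ℤ ℤ.≤_)

isZero⇒deg≡0 : ∀ p → isZero p ≡ true → deg p ≡ 0
isZero⇒deg≡0 []            _ = refl
isZero⇒deg≡0 (+ zero ∷ p) eq rewrite eq = refl

⊕-nonNegative : ∀ {p q} → NonNegative p → NonNegative q → NonNegative (p ⊕ q)
⊕-nonNegative []       q≥0      = q≥0
⊕-nonNegative (a ∷ p≥0) []       = a ∷ p≥0
⊕-nonNegative (a ∷ p≥0) (b ∷ q≥0) = ℤₚ.+-mono-≤ a b ∷ ⊕-nonNegative p≥0 q≥0

isZero-⊕ : ∀ {p q} → NonNegative p → NonNegative q →
           isZero (p ⊕ q) ≡ isZero p ∧ isZero q
isZero-⊕ [] _ = refl
isZero-⊕ {p} p≥0@(_ ∷ _) [] with isZero p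
... | true  = refl
... | false = refl
-- Two zero heads pass the question to the tails; a positive head on either side makes both sides
-- `false`.
isZero-⊕ (+≤+ {n = zero}  _ ∷ p≥0) (+≤+ {n = zero}  _ ∷ q≥0) = isZero-⊕ p≥0 q≥0
isZero-⊕ {_ ∷ p} (+≤+ {n = zero} _ ∷ _) (+≤+ {n = suc _} _ ∷ _) =
  sym (∧-zeroʳ (isZero p))
isZero-⊕ (+≤+ {n = suc _} _ ∷ _)   (+≤+ _ ∷ _)               = refl

-- `deg` branches on whether the tail vanishes, and by `isZero-⊕` the tail of the sum vanishes
-- exactly when both tails do. If only one does, its degree 0 is neutral for `⊔`.
deg-⊕ : ∀ {p q} → NonNegative p → NonNegative q → deg (p ⊕ q) ≡ deg p ⊔ deg q
deg-⊕ [] _ = refl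
deg-⊕ {p} (_ ∷ _) [] = sym (⊔-identityʳ (deg p))
deg-⊕ {_ ∷ p} {_ ∷ q} (_ ∷ p≥0) (_ ∷ q≥0)
  rewrite isZero-⊕ p≥0 q≥0 | deg-⊕ p≥0 q≥0
  with isZero p in p≡0 | isZero q in q≡0
... | true  | true  = refl
... | true  | false = cong (λ d → suc (d ⊔ deg q)) (isZero⇒deg≡0 p p≡0)
... | false | true  = cong suc
  (trans (cong (deg p ⊔_) (isZero⇒deg≡0 q q≡0)) (⊔-identityʳ (deg p)))
... | false | false = refl

-- The Stern recursion and the recurrences for `e`.

-- The call tree of the Stern recursion: recursion on it is induction along the
-- recurrences, and nested patterns reach two levels down.
data Stern : ℕ → Set where
  one  : Stern 1
  even : ∀ {k} → Stern k → Stern (2 * k)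
  odd  : ∀ {k} → Stern k → Stern (k + 1) → Stern (2 * k + 1)

Stern⇒1≤ : ∀ {n} → Stern n → 1 ≤ n
Stern⇒1≤ one             = ≤-refl
Stern⇒1≤ (even {k} s)    = ≤-trans (Stern⇒1≤ s) (m≤m+n k (k + 0))
Stern⇒1≤ (odd {k} _ _)   = m≤n+m 1 (2 * k)

stern : ∀ n → 1 ≤ n → Stern n
stern = <-rec (λ n → 1 ≤ n → Stern n) step
  where
  step : ∀ n → (∀ {m} → m < n → 1 ≤ m → Stern m) → 1 ≤ n → Stern n
  step n rec 1≤n with n divMod 2
  step _ rec ()  | result zero    zero       refl
  step _ rec _   | result zero    (suc zero) refl = one
  step _ rec _   | result (suc q) zero       refl =
    subst Stern (*-comm 2 (suc q))
      (even (rec (s≤s (s≤s (m≤m*n q 2))) (s≤s z≤n)))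
  step _ rec _   | result (suc q) (suc zero) refl =
    subst Stern (2k+1≡1+k2 (suc q))
      (odd (rec (s≤s (s≤s (m≤n⇒m≤1+n (m≤m*n q 2)))) (s≤s z≤n))
           (rec (s≤s (s≤s (subst (_≤ suc (q * 2)) (+-comm 1 q) (s≤s (m≤m*n q 2)))))
                (s≤s z≤n)))
    where
    2k+1≡1+k2 : ∀ k → 2 * k + 1 ≡ 1 + k * 2
    2k+1≡1+k2 = solve-∀

B-nonNegative : ∀ {n} → Stern n → NonNegative (B n)
B-nonNegative one = +≤+ z≤n ∷ []
B-nonNegative (even {k} s) rewrite B-even k (Stern⇒1≤ s) =
  +≤+ z≤n ∷ B-nonNegative s
B-nonNegative (odd {k} s t) rewrite B-odd k (Stern⇒1≤ s) =
  ⊕-nonNegative (B-nonNegative s) (B-nonNegative t)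

-- Multiplication by t raises `deg` by 1 only on nonzero polynomials, since `deg` sends both `[]`
-- and `t· []` to 0; `e-even` therefore rests on this.
B-nonZero : ∀ {n} → Stern n → isZero (B n) ≡ false
B-nonZero one = refl
B-nonZero (even {k} s) rewrite B-even k (Stern⇒1≤ s) = B-nonZero s
B-nonZero (odd {k} s t)
  rewrite B-odd k (Stern⇒1≤ s)
        | isZero-⊕ (B-nonNegative s) (B-nonNegative t)
        | B-nonZero s = refl

e-even : ∀ k → 1 ≤ k → e (2 * k) ≡ suc (e k)
e-even k 1≤k rewrite B-even k 1≤k | B-nonZero (stern k 1≤k) = refl

e-odd : ∀ k → 1 ≤ k → e (2 * k + 1) ≡ e k ⊔ e (k + 1)
e-odd k 1≤k rewrite B-odd k 1≤k =
  deg-⊕ (B-nonNegative (stern k 1≤k)) (B-nonNegative (stern (k + 1) (m≤n+m 1 k)))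

-- Exponential bounds relating an index to `e`.

2^e≤ : ∀ {n} → Stern n → 2 ^ e n ≤ n
2^e≤ one = ≤-refl
2^e≤ (even {k} s) rewrite e-even k (Stern⇒1≤ s) = *-monoʳ-≤ 2 (2^e≤ s)
2^e≤ (odd {k} s t) rewrite e-odd k (Stern⇒1≤ s) = begin
  2 ^ (e k ⊔ e (k + 1))       ≡⟨ mono-≤-distrib-⊔ (^-monoʳ-≤ 2) (e k) (e (k + 1)) ⟩
  2 ^ e k ⊔ 2 ^ e (k + 1)     ≤⟨ ⊔-lub (≤-trans (2^e≤ s) (m≤m+n k 1)) (2^e≤ t) ⟩
  k + 1                       ≤⟨ +-monoˡ-≤ 1 (m≤m+n k (k + 0)) ⟩
  2 * k + 1                   ∎
  where open ≤-Reasoning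

-- For n = 2k + 1, the bounds at k and k + 1 are too weak.  One of the two is even,
-- say 2j, and the bound at j together with e n ≥ e (2j) = e j + 1 suffices.
3n+1≤4^[1+e] : ∀ {n} → Stern n → 3 * n + 1 ≤ 4 ^ suc (e n)
3n+1≤4^[1+e] one = ≤-refl
3n+1≤4^[1+e] (even {k} s) rewrite e-even k (Stern⇒1≤ s) = begin
  3 * (2 * k) + 1               ≤⟨ m≤m+n _ (6 * k + 3) ⟩
  3 * (2 * k) + 1 + (6 * k + 3) ≡⟨ lemma k ⟩
  4 * (3 * k + 1)               ≤⟨ *-monoʳ-≤ 4 (3n+1≤4^[1+e] s) ⟩
  4 * 4 ^ suc (e k)             ∎
  where
  open ≤-Reasoning
  lemma : ∀ k → 3 * (2 * k) + 1 + (6 * k + 3) ≡ 4 * (3 * k + 1)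
  lemma = solve-∀
-- Here n = 3 and e 3 = 1, so the claim is 10 ≤ 16.
3n+1≤4^[1+e] (odd one _) = m≤m+n 10 6
3n+1≤4^[1+e] (odd (even {j} s) _)
  rewrite e-odd (2 * j) (Stern⇒1≤ (even s)) | e-even j (Stern⇒1≤ s) = begin
  -- An equality: n = 4j + 1 loses nothing from the bound at j, which is why iterating i ↦ 4i + 1
  -- stays sharp.
  3 * (2 * (2 * j) + 1) + 1 ≡⟨ lemma j ⟩
  4 * (3 * j + 1)           ≤⟨ *-monoʳ-≤ 4 (3n+1≤4^[1+e] s) ⟩
  4 ^ suc (suc (e j))       ≤⟨ ^-monoʳ-≤ 4 (s≤s (m≤m⊔n (suc (e j)) (e (2 * j + 1)))) ⟩
  4 ^ suc (suc (e j) ⊔ e (2 * j + 1)) ∎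
  where
  open ≤-Reasoning
  lemma : ∀ j → 3 * (2 * (2 * j) + 1) + 1 ≡ 4 * (3 * j + 1)
  lemma = solve-∀
3n+1≤4^[1+e] (odd (odd {j} s t) _)
  rewrite e-odd (2 * j + 1) (m≤n+m 1 (2 * j)) = begin
  -- Now n = 4j + 3 and k + 1 = 2(j + 1), so the bound at j + 1 is used; 6 is the slack.
  3 * (2 * (2 * j + 1) + 1) + 1     ≤⟨ m≤m+n _ 6 ⟩
  3 * (2 * (2 * j + 1) + 1) + 1 + 6 ≡⟨ lemma j ⟩
  4 * (3 * (j + 1) + 1)             ≤⟨ *-monoʳ-≤ 4 (3n+1≤4^[1+e] t) ⟩
  4 ^ suc (suc (e (j + 1)))         ≡⟨ cong (λ d → 4 ^ suc d) e≡ ⟨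
  4 ^ suc (e (2 * j + 1 + 1))       ≤⟨ ^-monoʳ-≤ 4 (s≤s (m≤n⊔m (e (2 * j + 1)) (e (2 * j + 1 + 1)))) ⟩
  4 ^ suc (e (2 * j + 1) ⊔ e (2 * j + 1 + 1)) ∎
  where
  open ≤-Reasoning
  lemma : ∀ j → 3 * (2 * (2 * j + 1) + 1) + 1 + 6 ≡ 4 * (3 * (j + 1) + 1)
  lemma = solve-∀
  double : ∀ j → 2 * j + 1 + 1 ≡ 2 * (j + 1)
  double = solve-∀
  e≡ : e (2 * j + 1 + 1) ≡ suc (e (j + 1))
  e≡ = trans (cong e (double j)) (e-even (j + 1) (Stern⇒1≤ t))

-- Induction enters only for n = 2k, through e (k + 1) ≤ e k + 1. For n = 2k + 1, e (n + 1) = e (k +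
-- 1) + 1, and e (k + 1) is one of the two terms whose maximum is e n.
e[n+1]≤1+e[n] : ∀ {n} → Stern n → e (n + 1) ≤ suc (e n)
e[n+1]≤1+e[n] one = ≤-refl
e[n+1]≤1+e[n] (even {k} s)
  rewrite e-odd k (Stern⇒1≤ s) | e-even k (Stern⇒1≤ s) =
  ⊔-lub (m≤n+m (e k) 2) (m≤n⇒m≤1+n (e[n+1]≤1+e[n] s))
e[n+1]≤1+e[n] (odd {k} s t) rewrite e-odd k (Stern⇒1≤ s) = begin
  e (2 * k + 1 + 1)          ≡⟨ cong e (double k) ⟩
  e (2 * (k + 1))            ≡⟨ e-even (k + 1) (Stern⇒1≤ t) ⟩
  suc (e (k + 1))            ≤⟨ s≤s (m≤n⊔m (e k) _) ⟩
  suc (e k ⊔ e (k + 1))      ∎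
  where
  open ≤-Reasoning
  double : ∀ k → 2 * k + 1 + 1 ≡ 2 * (k + 1)
  double = solve-∀

e[4n+1]≡1+e[n] : ∀ n → 1 ≤ n → e (4 * n + 1) ≡ suc (e n)
e[4n+1]≡1+e[n] n 1≤n = begin
  e (4 * n + 1)                      ≡⟨ cong e (quadruple n) ⟩
  e (2 * (2 * n) + 1)                ≡⟨ e-odd (2 * n) (≤-trans 1≤n (m≤m+n n _)) ⟩
  e (2 * n) ⊔ e (2 * n + 1)          ≡⟨ cong₂ _⊔_ (e-even n 1≤n) (e-odd n 1≤n) ⟩
  suc (e n) ⊔ (e n ⊔ e (n + 1))      ≡⟨ m≥n⇒m⊔n≡m
                                          (⊔-lub (n≤1+n (e n)) (e[n+1]≤1+e[n] (stern n 1≤n))) ⟩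
  suc (e n)                          ∎
  where
  open Relation.Binary.PropositionalEquality.≡-Reasoning
  quadruple : ∀ n → 4 * n + 1 ≡ 2 * (2 * n) + 1
  quadruple = solve-∀

-- Extreme values of `e` between consecutive powers of 2.

1≤2^ : ∀ n → 1 ≤ 2 ^ n
1≤2^ n = m^n>0 2 n

e[2^n]≡n : ∀ n → e (2 ^ n) ≡ n
e[2^n]≡n zero    = refl
e[2^n]≡n (suc n) = trans (e-even (2 ^ n) (1≤2^ n)) (cong suc (e[2^n]≡n n))

e≤ : ∀ {n i} → 1 ≤ i → i ≤ 2 ^ n → e i ≤ n
e≤ {n} {i} 1≤i i≤2^n = ≮⇒≥ λ n<e →
  <⇒≱ (^-monoʳ-< 2 (s≤s (s≤s z≤n)) n<e) (≤-trans (2^e≤ (stern i 1≤i)) i≤2^n)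

-- From 2 ^ (n + 1) ≤ 2i < 3i + 1 ≤ 4 ^ (e i + 1), comparing exponents of 2 strictly gives n ≤ 2 e
-- i; then halve.
⌊/2⌋≤e : ∀ n {i} → 2 ^ n ≤ i → ⌊ suc n /2⌋ ≤ e i
⌊/2⌋≤e n {i} 2^n≤i = begin
  ⌊ suc n /2⌋                ≤⟨ ⌊n/2⌋-mono (s≤s n≤2e) ⟩
  ⌊ suc (e i + e i) /2⌋      ≡⟨ n≡⌈n+n/2⌉ (e i) ⟨
  e i                        ∎
  where
  open ≤-Reasoning
  double : ∀ d → 2 * suc d ≡ suc (suc (d + d))
  double = solve-∀
  2^[1+n]<2^[2+2e] : 2 ^ suc n < 2 ^ suc (suc (e i + e i))
  2^[1+n]<2^[2+2e] = begin-strict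
    2 * 2 ^ n                   ≤⟨ *-monoʳ-≤ 2 2^n≤i ⟩
    2 * i                       ≤⟨ *-monoˡ-≤ i (n≤1+n 2) ⟩
    3 * i                       <⟨ m<m+n (3 * i) (s≤s z≤n) ⟩
    3 * i + 1                   ≤⟨ 3n+1≤4^[1+e] (stern i (≤-trans (1≤2^ n) 2^n≤i)) ⟩
    (2 ^ 2) ^ suc (e i)         ≡⟨ ^-*-assoc 2 2 (suc (e i)) ⟩
    2 ^ (2 * suc (e i))         ≡⟨ cong (2 ^_) (double (e i)) ⟩
    2 ^ suc (suc (e i + e i))   ∎
  n≤2e : n ≤ e i + e i
  n≤2e = ≮⇒≥ λ 2e<n →
    <⇒≱ 2^[1+n]<2^[2+2e] (^-monoʳ-≤ 2 (s≤s 2e<n))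

-- The strict upper bound is what survives the step i ↦ 4i + 1.
∃e≡⌊/2⌋ : ∀ n → ∃[ i ] (2 ^ n ≤ i × i < 2 ^ suc n × e i ≡ ⌊ suc n /2⌋)
∃e≡⌊/2⌋ 0 = 1 , ≤-refl , ≤-refl , refl
∃e≡⌊/2⌋ 1 = 2 , ≤-refl , n≤1+n 3 , refl
-- The map i ↦ 4i + 1 moves up two powers of 2 while `e` grows by 1, hence the two base cases.
∃e≡⌊/2⌋ (suc (suc n)) with i , lo , hi , eq ← ∃e≡⌊/2⌋ n =
  4 * i + 1 , lower , upper ,
  trans (e[4n+1]≡1+e[n] i (≤-trans (1≤2^ n) lo)) (cong suc eq)
  where
  open ≤-Reasoning
  lower : 2 ^ suc (suc n) ≤ 4 * i + 1
  lower = begin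
    2 * (2 * 2 ^ n)  ≡⟨ *-assoc 2 2 (2 ^ n) ⟨
    4 * 2 ^ n        ≤⟨ *-monoʳ-≤ 4 lo ⟩
    4 * i            ≤⟨ m≤m+n (4 * i) 1 ⟩
    4 * i + 1        ∎
  expand : ∀ i → suc (4 * i + 1) + 2 ≡ 4 * suc i
  expand = solve-∀
  upper : 4 * i + 1 < 2 ^ suc (suc (suc n))
  upper = begin
    suc (4 * i + 1)       ≤⟨ m≤m+n _ 2 ⟩
    suc (4 * i + 1) + 2   ≡⟨ expand i ⟩
    4 * suc i             ≤⟨ *-monoʳ-≤ 4 hi ⟩
    4 * 2 ^ suc n         ≡⟨ *-assoc 2 2 (2 ^ suc n) ⟩
    2 * (2 * 2 ^ suc n)   ∎

-- The numbers 1, 5, 21, 85, ..., in binary 1, 101, 10101, 1010101, ...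
lastIndex : ℕ → ℕ
lastIndex zero    = 1
lastIndex (suc n) = 4 * lastIndex n + 1

1≤lastIndex : ∀ n → 1 ≤ lastIndex n
1≤lastIndex zero    = ≤-refl
1≤lastIndex (suc n) = m≤n+m 1 (4 * lastIndex n)

e[lastIndex]≡n : ∀ n → e (lastIndex n) ≡ n
e[lastIndex]≡n zero    = refl
e[lastIndex]≡n (suc n) =
  trans (e[4n+1]≡1+e[n] (lastIndex n) (1≤lastIndex n)) (cong suc (e[lastIndex]≡n n))

-- Free of truncated subtraction and division, this form turns `3n+1≤4^[1+e]` directly into
-- `≤lastIndex`.
3lastIndex+1 : ∀ n → 3 * lastIndex n + 1 ≡ 4 ^ suc n
3lastIndex+1 zero    = refl
3lastIndex+1 (suc n) = trans (lemma (lastIndex n)) (cong (4 *_) (3lastIndex+1 n))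
  where
  lemma : ∀ a → 3 * (4 * a + 1) + 1 ≡ 4 * (3 * a + 1)
  lemma = solve-∀

lastIndex-closed : ∀ n → (4 ^ (n + 1) ∸ 1) / 3 ≡ lastIndex n
lastIndex-closed n
  rewrite +-comm n 1 | sym (3lastIndex+1 n) | m+n∸n≡m (3 * lastIndex n) 1
        | *-comm 3 (lastIndex n) = m*n/n≡m (lastIndex n) 3

≤lastIndex : ∀ {i} → 1 ≤ i → i ≤ lastIndex (e i)
≤lastIndex {i} 1≤i = *-cancelˡ-≤ 3 (+-cancelʳ-≤ 1 _ _
  (≤-trans (3n+1≤4^[1+e] (stern i 1≤i)) (≤-reflexive (sym (3lastIndex+1 (e i))))))

theorem4p3 : (∀ n → 2 ≤ n →
    IsMin (λ m → ∃[ i ] (2 ^ (n ∸ 1) ≤ i × i ≤ 2 ^ n × m ≡ e i)) ⌊ n /2⌋)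
    × (∀ n → 1 ≤ n →
    IsMax (λ m → ∃[ i ] (2 ^ (n ∸ 1) ≤ i × i ≤ 2 ^ n × m ≡ e i)) n)
    × (∀ n → IsMin (λ i → 1 ≤ i × e i ≡ n) (2 ^ n))
    × (∀ n → IsMax (λ i → 1 ≤ i × e i ≡ n) ((4 ^ (n + 1) ∸ 1) / 3))
theorem4p3 = minimum , maximum , first , last
  where
  minimum : ∀ n → 2 ≤ n →
    IsMin (λ m → ∃[ i ] (2 ^ (n ∸ 1) ≤ i × i ≤ 2 ^ n × m ≡ e i)) ⌊ n /2⌋
  minimum (suc n) _ with i , lo , hi , eq ← ∃e≡⌊/2⌋ n =
    (i , lo , <⇒≤ hi , sym eq) , λ { (_ , 2^n≤j , _ , refl) → ⌊/2⌋≤e n 2^n≤j }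

  maximum : ∀ n → 1 ≤ n →
    IsMax (λ m → ∃[ i ] (2 ^ (n ∸ 1) ≤ i × i ≤ 2 ^ n × m ≡ e i)) n
  maximum n _ =
    -- The closed right endpoint is the only possible witness: by `2^e≤`, e i = n forces 2 ^ n ≤ i.
    (2 ^ n , ^-monoʳ-≤ 2 (m∸n≤m n 1) , ≤-refl , sym (e[2^n]≡n n)) ,
    λ { (_ , lo , hi , refl) → e≤ (≤-trans (1≤2^ (n ∸ 1)) lo) hi }

  first : ∀ n → IsMin (λ i → 1 ≤ i × e i ≡ n) (2 ^ n)
  first n = (1≤2^ n , e[2^n]≡n n) , λ { (1≤i , refl) → 2^e≤ (stern _ 1≤i) }

  last : ∀ n → IsMax (λ i → 1 ≤ i × e i ≡ n) ((4 ^ (n + 1) ∸ 1) / 3)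
  last n rewrite lastIndex-closed n =
    (1≤lastIndex n , e[lastIndex]≡n n) , λ { (1≤i , refl) → ≤lastIndex 1≤i }
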